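{- Let $F$ be a face of $\mathcal P_\Phi$. The set $V_F=\Phi\cap F$ of the roots in $F$ is not the union of two nonempty subsets $V_1,V_2$ such that every root in $V_1$ is orthogonal to every root in $V_2$.
   Context: $\Phi$ is a finite irreducible reduced crystallographic root system in the Euclidean space $\mathrm{Span}_{\mathbb R}\Phi$ with scalar product $(\cdot,\cdot)$. $\mathcal P_\Phi$ is the convex hull of $\Phi$. Faces are nonempty. -}

module Defs where

open import Algebra.Bundles using (CommutativeRing)
open import Algebra.Module.Bundles using (Module)
import Algebra.Definitions.RawMonoid as RawMonoidDefs
import Algebra.Module.Construct.TensorUnit as TensorUnit
open import Algebra.Module.Morphism.Structures using (module ModuleMorphisms)
open import Data.Fin.Base using (Fin)
open import Data.Nat.Base using (ℕ)
open import Data.Product.Base using (Σ; ∃; ∃₂; _×_)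
open import Data.Sum.Base using (_⊎_)
open import Level using (Level; suc)
open import Relation.Binary.Core using (Rel)
open import Relation.Binary.Structures using (IsDecTotalOrder)
open import Relation.Nullary.Negation.Core using (¬_)
open import Relation.Unary
  using (Pred; _∈_; _∉_; _≐_; _∩_; _∪_; Satisfiable; Universal)

-- The field of real numbers, given axiomatically as a Dedekind-complete
-- ordered field; classically this determines it up to isomorphism.  The
-- order is the classical one, hence decidable.
record RealField (ℓ : Level) : Set (suc ℓ) where
  infix  4 _≤_
  infix  8 _⁻¹
  field
    commutativeRing : CommutativeRing ℓ ℓ

  open CommutativeRing commutativeRing public

  field
    _≤_             : Rel Carrier ℓ
    isDecTotalOrder : IsDecTotalOrder _≈_ _≤_
    0≉1             : ¬ 0# ≈ 1#
    -- Total, with an unspecified value at 0#.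
    _⁻¹             : Carrier → Carrier
    ⁻¹-cong         : ∀ {x y} → x ≈ y → x ⁻¹ ≈ y ⁻¹
    ⁻¹-inverseʳ     : ∀ x → ¬ x ≈ 0# → x * x ⁻¹ ≈ 1#
    +-monoʳ-≤       : ∀ x {y z} → y ≤ z → x + y ≤ x + z
    *-nonNeg        : ∀ {x y} → 0# ≤ x → 0# ≤ y → 0# ≤ x * y

  UpperBound : Pred Carrier ℓ → Pred Carrier ℓ
  UpperBound S b = ∀ {x} → x ∈ S → x ≤ b

  field
    complete : (S : Pred Carrier ℓ) → Satisfiable S → Satisfiable (UpperBound S) →
               ∃ λ s → UpperBound S s × (∀ {b} → b ∈ UpperBound S → s ≤ b)

  open RawMonoidDefs +-rawMonoid public
    using (sum) renaming (_×_ to _·_)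

  2# : Carrier
  2# = 1# + 1#

  IsInteger : Pred Carrier ℓ
  IsInteger x = ∃ λ (n : ℕ) → (x ≈ n · 1#) ⊎ (x ≈ - (n · 1#))

module _ {ℓ : Level} (ℝ : RealField ℓ) where
  private module ℝ = RealField ℝ

  IsLinearFunctional : (V : Module ℝ.commutativeRing ℓ ℓ) →
                       (Module.Carrierᴹ V → ℝ.Carrier) → Set ℓ
  IsLinearFunctional V =
    ModuleMorphisms.IsModuleHomomorphism (Module.rawModule V)
      (Module.rawModule (TensorUnit.⟨module⟩ {R = ℝ.commutativeRing}))

  -- A real vector space with a scalar product.  Finite-dimensionality is not
  -- a field: it is forced by the existence of a finite spanning set, which is
  -- part of IsRootSystem below.
  record InnerProductSpace : Set (suc ℓ) where
    field
      vectorSpace : Module ℝ.commutativeRing ℓ ℓ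

    open Module vectorSpace public

    field
      ⟨_,_⟩      : Carrierᴹ → Carrierᴹ → ℝ.Carrier
      ⟨⟩-sym     : ∀ x y → ⟨ x , y ⟩ ℝ.≈ ⟨ y , x ⟩
      ⟨⟩-linear  : ∀ y → IsLinearFunctional vectorSpace (λ x → ⟨ x , y ⟩)
      ⟨⟩-nonNeg  : ∀ x → ℝ.0# ℝ.≤ ⟨ x , x ⟩
      ⟨⟩-nondeg  : ∀ x → ⟨ x , x ⟩ ℝ.≈ ℝ.0# → x ≈ᴹ 0ᴹ

    open RawMonoidDefs +ᴹ-rawMonoid public using () renaming (sum to sumᴹ)

module _ {ℓ : Level} {ℝ : RealField ℓ} (E : InnerProductSpace ℝ) where
  open RealField ℝ
  open InnerProductSpace E

  Finite : Pred Carrierᴹ ℓ → Set ℓ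
  Finite S = ∃ λ (n : ℕ) → Σ (Fin n → Carrierᴹ) λ p →
             S ≐ (λ x → ∃ λ i → x ≈ᴹ p i)

  Span : Pred Carrierᴹ ℓ → Pred Carrierᴹ ℓ
  Span S x = ∃ λ (k : ℕ) → ∃₂ λ (w : Fin k → Carrier) (p : Fin k → Carrierᴹ) →
             (∀ i → p i ∈ S) × (x ≈ᴹ sumᴹ (λ i → w i *ₗ p i))

  ConvexHull : Pred Carrierᴹ ℓ → Pred Carrierᴹ ℓ
  ConvexHull S x = ∃ λ (k : ℕ) → ∃₂ λ (w : Fin k → Carrier) (p : Fin k → Carrierᴹ) →
                   (∀ i → p i ∈ S) × (∀ i → 0# ≤ w i) × (sum w ≈ 1#) ×
                   (x ≈ᴹ sumᴹ (λ i → w i *ₗ p i))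

  -- Nonempty faces, cut out by valid inequalities f x ≤ c.  The polytope P
  -- itself is a face (f = 0, c = 0).
  IsFace : (P F : Pred Carrierᴹ ℓ) → Set ℓ
  IsFace P F =
    Satisfiable F ×
    (∃₂ λ (f : Carrierᴹ → Carrier) (c : Carrier) →
       IsLinearFunctional ℝ vectorSpace f ×
       (∀ {x} → x ∈ P → f x ≤ c) ×
       (F ≐ P ∩ (λ x → f x ≈ c)))

  cartan : Carrierᴹ → Carrierᴹ → Carrier
  cartan β α = (2# * ⟨ β , α ⟩) * ⟨ α , α ⟩ ⁻¹

  reflect : Carrierᴹ → Carrierᴹ → Carrierᴹ
  reflect α β = β +ᴹ -ᴹ (cartan β α *ₗ α)

  record IsRootSystem (Φ : Pred Carrierᴹ ℓ) : Set ℓ where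
    field
      finite           : Finite Φ
      spanning         : Universal (Span Φ)
      0∉Φ              : 0ᴹ ∉ Φ
      reflection       : ∀ {α β} → α ∈ Φ → β ∈ Φ → reflect α β ∈ Φ
      crystallographic : ∀ {α β} → α ∈ Φ → β ∈ Φ → IsInteger (cartan β α)
      reduced          : ∀ {α} c → α ∈ Φ → (c *ₗ α) ∈ Φ → (c ≈ 1#) ⊎ (c ≈ - 1#)

  -- Disjointness of S₁ and S₂ is not required; for sets of nonzero vectors
  -- it follows from orthogonality.
  OrthogonallyDecomposable : Pred Carrierᴹ ℓ → Set (suc ℓ)
  OrthogonallyDecomposable S =
    ∃₂ λ (S₁ S₂ : Pred Carrierᴹ ℓ) →
      Satisfiable S₁ × Satisfiable S₂ × (S ≐ S₁ ∪ S₂) ×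
      (∀ {α β} → α ∈ S₁ → β ∈ S₂ → ⟨ α , β ⟩ ≈ 0#)

  Irreducible : Pred Carrierᴹ ℓ → Set (suc ℓ)
  Irreducible Φ = Satisfiable Φ × ¬ OrthogonallyDecomposable Φ

{-# OPTIONS --safe #-}
-- Let α ∈ S₁ and β ∈ S₂, where Φ ∩ F is the orthogonal union of S₁ and S₂ and
-- F is cut out by f ≤ c.  Irreducibility yields a root γ orthogonal to neither
-- α nor β.  Reflecting γ in α and β, which are orthogonal, makes the Cartan
-- integers m of (γ , α) and n of (γ , β) both positive.  The root
-- s_α s_β γ = γ - n β - m α satisfies f ≥ - c, so f γ ≥ (m + n - 1) c ≥ c.
-- Hence γ ∈ Φ ∩ F, although γ is orthogonal to neither α nor β.
module Submission where

open import Defs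
open import Level using (Level)
open import Algebra.Module.Morphism.Structures using (module ModuleMorphisms)
import Algebra.Properties.AbelianGroup as AbelianGroupProperties
import Algebra.Properties.Ring as RingProperties
open import Data.Empty using (⊥; ⊥-elim)
open import Data.Fin.Base using (Fin)
open import Data.Fin.Properties using (any?)
open import Data.Nat.Base using (zero; suc)
open import Data.Product.Base using (∃; _×_; _,_; proj₁; proj₂)
open import Data.Sum.Base using (_⊎_; inj₁; inj₂; [_,_]′)
open import Relation.Binary.Bundles using (DecTotalOrder)
import Relation.Binary.Reasoning.PartialOrder as PosetReasoning
import Relation.Binary.Reasoning.Setoid as SetoidReasoning
open import Relation.Binary.Structures using (IsDecTotalOrder)
open import Relation.Nullary.Decidable.Core using (Dec; yes; no; _×-dec_; ¬?; decidable-stable)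
open import Relation.Nullary.Negation.Core using (¬_)
open import Relation.Unary using (Pred; _∈_; _∩_)

-- Arithmetic in the ordered field of real numbers.

module OrderedField {ℓ : Level} (ℝ : RealField ℓ) where
  open RealField ℝ
  open IsDecTotalOrder isDecTotalOrder public
    using (_≟_; total; antisym)
    renaming (trans to ≤-trans; reflexive to ≤-reflexive)
  open RingProperties ring using (-‿distribʳ-*; -‿involutive; -0#≈0#)
  open AbelianGroupProperties +-abelianGroup using (//-rightDividesˡ; ∙-cancelˡ)

  decTotalOrder : DecTotalOrder ℓ ℓ ℓ
  decTotalOrder = record { isDecTotalOrder = isDecTotalOrder }

  open PosetReasoning (DecTotalOrder.poset decTotalOrder)

  +-monoˡ-≤ : ∀ x {y z} → y ≤ z → y + x ≤ z + x
  +-monoˡ-≤ x {y} {z} y≤z = begin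
    y + x  ≈⟨ +-comm y x ⟩
    x + y  ≤⟨ +-monoʳ-≤ x y≤z ⟩
    x + z  ≈⟨ +-comm x z ⟩
    z + x  ∎

  x≤y-z⇒x+z≤y : ∀ {x y z} → x ≤ y + - z → x + z ≤ y
  x≤y-z⇒x+z≤y {x} {y} {z} x≤y-z = begin
    x + z          ≤⟨ +-monoˡ-≤ z x≤y-z ⟩
    (y + - z) + z  ≈⟨ //-rightDividesˡ z y ⟩
    y              ∎

  neg-antimono-≤ : ∀ {x y} → x ≤ y → - y ≤ - x
  neg-antimono-≤ {x} {y} x≤y = begin
    - y                ≈⟨ +-identityʳ (- y) ⟨
    - y + 0#           ≈⟨ +-congˡ (-‿inverseʳ x) ⟨
    - y + (x + - x)    ≤⟨ +-monoʳ-≤ (- y) (+-monoˡ-≤ (- x) x≤y) ⟩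
    - y + (y + - x)    ≈⟨ +-assoc (- y) y (- x) ⟨
    (- y + y) + - x    ≈⟨ +-congʳ (-‿inverseˡ y) ⟩
    0# + - x           ≈⟨ +-identityˡ (- x) ⟩
    - x                ∎

  x≤0⇒0≤-x : ∀ {x} → x ≤ 0# → 0# ≤ - x
  x≤0⇒0≤-x x≤0 = ≤-trans (≤-reflexive (sym -0#≈0#)) (neg-antimono-≤ x≤0)

  -x≤x⇒0≤x : ∀ {x} → - x ≤ x → 0# ≤ x
  -x≤x⇒0≤x {x} -x≤x with total 0# x
  ... | inj₁ 0≤x = 0≤x
  ... | inj₂ x≤0 = ≤-trans (x≤0⇒0≤-x x≤0) -x≤x

  0≤1 : 0# ≤ 1#
  0≤1 with total 0# 1#
  ... | inj₁ p   = p
  -- If 1 were at most 0, then - 1 would be nonnegative, and so would its square, which is 1.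
  ... | inj₂ 1≤0 = begin
    0#           ≤⟨ *-nonNeg (x≤0⇒0≤-x 1≤0) (x≤0⇒0≤-x 1≤0) ⟩
    - 1# * - 1#  ≈⟨ -‿distribʳ-* (- 1#) 1# ⟨
    - (- 1# * 1#)  ≈⟨ -‿cong (*-identityʳ (- 1#)) ⟩
    - (- 1#)     ≈⟨ -‿involutive 1# ⟩
    1#           ∎

  1≤1+x : ∀ {x} → 0# ≤ x → 1# ≤ 1# + x
  1≤1+x {x} 0≤x = begin
    1#       ≈⟨ +-identityʳ 1# ⟨
    1# + 0#  ≤⟨ +-monoʳ-≤ 1# 0≤x ⟩
    1# + x   ∎

  2≉0 : ¬ 2# ≈ 0#
  2≉0 2≈0 = 0≉1 (antisym 0≤1 (≤-trans (1≤1+x 0≤1) (≤-reflexive 2≈0)))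

  0≤n·1 : ∀ n → 0# ≤ n · 1#
  0≤n·1 zero    = ≤-reflexive refl
  0≤n·1 (suc n) = ≤-trans 0≤1 (1≤1+x (0≤n·1 n))

  -- This is how integrality enters: a nonvanishing Cartan number is bounded away from 0 by 1, on
  -- one side or the other.
  nonzero-integer : ∀ {x} → IsInteger x → ¬ x ≈ 0# → 1# ≤ x ⊎ 1# ≤ - x
  nonzero-integer (zero , inj₁ x≈0) x≉0 = ⊥-elim (x≉0 x≈0)
  nonzero-integer (zero , inj₂ x≈-0) x≉0 = ⊥-elim (x≉0 (trans x≈-0 -0#≈0#))
  nonzero-integer (suc n , inj₁ x≈n) _ =
    inj₁ (≤-trans (1≤1+x (0≤n·1 n)) (≤-reflexive (sym x≈n)))
  nonzero-integer (suc n , inj₂ x≈-n) _ =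
    inj₂ (≤-trans (1≤1+x (0≤n·1 n))
                  (≤-reflexive (trans (sym (-‿involutive _)) (-‿cong (sym x≈-n)))))

  -- The difference x * y - y is (x - 1) * y, a product of nonnegative factors.
  1≤x⇒y≤x*y : ∀ {x y} → 1# ≤ x → 0# ≤ y → y ≤ x * y
  1≤x⇒y≤x*y {x} {y} 1≤x 0≤y = begin
    y                     ≈⟨ +-identityˡ y ⟨
    0# + y                ≤⟨ +-monoˡ-≤ y (*-nonNeg 0≤x-1 0≤y) ⟩
    (x + - 1#) * y + y    ≈⟨ +-congˡ (*-identityˡ y) ⟨
    (x + - 1#) * y + 1# * y  ≈⟨ distribʳ y (x + - 1#) 1# ⟨
    ((x + - 1#) + 1#) * y    ≈⟨ *-congʳ (//-rightDividesˡ 1# x) ⟩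
    x * y                 ∎
    where
    0≤x-1 : 0# ≤ x + - 1#
    0≤x-1 = ≤-trans (≤-reflexive (sym (-‿inverseʳ 1#))) (+-monoˡ-≤ (- 1#) 1≤x)

  x*y≈0⇒y≈0 : ∀ {x y} → ¬ x ≈ 0# → x * y ≈ 0# → y ≈ 0#
  x*y≈0⇒y≈0 {x} {y} x≉0 xy≈0 = begin-equality
    y               ≈⟨ *-identityˡ y ⟨
    1# * y          ≈⟨ *-congʳ (⁻¹-inverseʳ x x≉0) ⟨
    (x * x ⁻¹) * y  ≈⟨ *-congʳ (*-comm x (x ⁻¹)) ⟩
    (x ⁻¹ * x) * y  ≈⟨ *-assoc (x ⁻¹) x y ⟩
    x ⁻¹ * (x * y)  ≈⟨ *-congˡ xy≈0 ⟩
    x ⁻¹ * 0#       ≈⟨ zeroʳ (x ⁻¹) ⟩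
    0#              ∎

  x-2x≈-x : ∀ x → x + - (2# * x) ≈ - x
  x-2x≈-x x = ∙-cancelˡ x _ _ (begin-equality
    x + (x + - (2# * x))     ≈⟨ +-assoc x x _ ⟨
    (x + x) + - (2# * x)     ≈⟨ +-congʳ (+-cong (*-identityˡ x) (*-identityˡ x)) ⟨
    (1# * x + 1# * x) + - (2# * x)  ≈⟨ +-congʳ (distribʳ x 1# 1#) ⟨
    2# * x + - (2# * x)      ≈⟨ -‿inverseʳ _ ⟩
    0#                       ≈⟨ -‿inverseʳ x ⟨
    x + - x                  ∎)

-- Reflections and Cartan numbers.

module _ {ℓ : Level} {ℝ : RealField ℓ} (E : InnerProductSpace ℝ) where
  open RealField ℝ
  open InnerProductSpace E
  open OrderedField ℝ
  open SetoidReasoning setoid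
  open RingProperties ring using (-‿distribˡ-*; -‿distribʳ-*; -‿involutive; -0#≈0#)

  module LinearFunctional (f : Carrierᴹ → Carrier)
                          (f-linear : IsLinearFunctional ℝ vectorSpace f) where
    open ModuleMorphisms.IsModuleHomomorphism f-linear public
      using (+ᴹ-homo; -ᴹ-homo; *ₗ-homo; ⟦⟧-cong)

    -- Stated for any linear functional, so that it serves both the scalar product with a fixed
    -- vector and the functional that cuts out the face.
    reflect-homo : ∀ α β → f (reflect E α β) ≈ f β + - (cartan E β α * f α)
    reflect-homo α β = trans (+ᴹ-homo _ _)
      (+-congˡ (trans (-ᴹ-homo _) (-‿cong (*ₗ-homo _ _))))

  ⟨⟩-reflect : ∀ α β γ →
    ⟨ reflect E α β , γ ⟩ ≈ ⟨ β , γ ⟩ + - (cartan E β α * ⟨ α , γ ⟩)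
  ⟨⟩-reflect α β γ = LinearFunctional.reflect-homo _ (⟨⟩-linear γ) α β

  -- The reflection moves β by a multiple of α, which pairs to 0 with γ.
  ⟨⟩-reflect-⊥ : ∀ {α γ} β → ⟨ α , γ ⟩ ≈ 0# → ⟨ reflect E α β , γ ⟩ ≈ ⟨ β , γ ⟩
  ⟨⟩-reflect-⊥ {α} {γ} β α⊥γ = begin
    ⟨ reflect E α β , γ ⟩                      ≈⟨ ⟨⟩-reflect α β γ ⟩
    ⟨ β , γ ⟩ + - (cartan E β α * ⟨ α , γ ⟩)  ≈⟨ +-congˡ (-‿cong (trans (*-congˡ α⊥γ) (zeroʳ _))) ⟩
    ⟨ β , γ ⟩ + - 0#                          ≈⟨ +-congˡ -0#≈0# ⟩
    ⟨ β , γ ⟩ + 0#                            ≈⟨ +-identityʳ _ ⟩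
    ⟨ β , γ ⟩                                 ∎

  cartan-congˡ : ∀ {β γ} α → ⟨ β , α ⟩ ≈ ⟨ γ , α ⟩ → cartan E β α ≈ cartan E γ α
  cartan-congˡ α eq = *-congʳ (*-congˡ eq)

  cartan-reflect-⊥ : ∀ {α γ} β → ⟨ α , γ ⟩ ≈ 0# →
                     cartan E (reflect E α β) γ ≈ cartan E β γ
  cartan-reflect-⊥ {γ = γ} β α⊥γ = cartan-congˡ γ (⟨⟩-reflect-⊥ β α⊥γ)

  cartan-*-⟨⟩ : ∀ {α} β → ¬ ⟨ α , α ⟩ ≈ 0# →
                cartan E β α * ⟨ α , α ⟩ ≈ 2# * ⟨ β , α ⟩
  cartan-*-⟨⟩ {α} β αα≉0 = begin
    ((2# * ⟨ β , α ⟩) * ⟨ α , α ⟩ ⁻¹) * ⟨ α , α ⟩  ≈⟨ *-assoc _ _ _ ⟩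
    (2# * ⟨ β , α ⟩) * (⟨ α , α ⟩ ⁻¹ * ⟨ α , α ⟩)  ≈⟨ *-congˡ (*-comm _ _) ⟩
    (2# * ⟨ β , α ⟩) * (⟨ α , α ⟩ * ⟨ α , α ⟩ ⁻¹)  ≈⟨ *-congˡ (⁻¹-inverseʳ _ αα≉0) ⟩
    (2# * ⟨ β , α ⟩) * 1#                          ≈⟨ *-identityʳ _ ⟩
    2# * ⟨ β , α ⟩                                 ∎

  cartan≉0 : ∀ {α β} → ¬ ⟨ α , α ⟩ ≈ 0# → ¬ ⟨ β , α ⟩ ≈ 0# → ¬ cartan E β α ≈ 0#
  cartan≉0 {α} {β} αα≉0 βα≉0 n≈0 = βα≉0 (x*y≈0⇒y≈0 2≉0 (begin
    2# * ⟨ β , α ⟩            ≈⟨ cartan-*-⟨⟩ β αα≉0 ⟨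
    cartan E β α * ⟨ α , α ⟩  ≈⟨ *-congʳ n≈0 ⟩
    0# * ⟨ α , α ⟩            ≈⟨ zeroˡ _ ⟩
    0#                        ∎))

  cartan-self : ∀ {α} → ¬ ⟨ α , α ⟩ ≈ 0# → cartan E α α ≈ 2#
  cartan-self {α} αα≉0 = trans (*-assoc _ _ _)
    (trans (*-congˡ (⁻¹-inverseʳ _ αα≉0)) (*-identityʳ _))

  cartan-reflect-self : ∀ {α} β → ¬ ⟨ α , α ⟩ ≈ 0# →
                        cartan E (reflect E α β) α ≈ - cartan E β α
  cartan-reflect-self {α} β αα≉0 = begin
    (2# * ⟨ reflect E α β , α ⟩) * ⟨ α , α ⟩ ⁻¹  ≈⟨ *-congʳ (*-congˡ negated) ⟩
    (2# * - ⟨ β , α ⟩) * ⟨ α , α ⟩ ⁻¹            ≈⟨ *-congʳ (-‿distribʳ-* _ _) ⟨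
    - (2# * ⟨ β , α ⟩) * ⟨ α , α ⟩ ⁻¹            ≈⟨ -‿distribˡ-* _ _ ⟨
    - cartan E β α                               ∎
    where
    negated : ⟨ reflect E α β , α ⟩ ≈ - ⟨ β , α ⟩
    negated = begin
      ⟨ reflect E α β , α ⟩                      ≈⟨ ⟨⟩-reflect α β α ⟩
      ⟨ β , α ⟩ + - (cartan E β α * ⟨ α , α ⟩)  ≈⟨ +-congˡ (-‿cong (cartan-*-⟨⟩ β αα≉0)) ⟩
      ⟨ β , α ⟩ + - (2# * ⟨ β , α ⟩)            ≈⟨ x-2x≈-x _ ⟩
      - ⟨ β , α ⟩                               ∎

  ⊆-ConvexHull : ∀ {S : Pred Carrierᴹ ℓ} {x} → x ∈ S → x ∈ ConvexHull E S
  ⊆-ConvexHull {x = x} x∈S =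
    -- The convex combination with one term, of weight 1.
    1 , (λ _ → 1#) , (λ _ → x) , (λ _ → x∈S) , (λ _ → 0≤1) , +-identityʳ 1# ,
    ≈ᴹ-sym (≈ᴹ-trans (+ᴹ-identityʳ _) (*ₗ-identityˡ x))

  module RootSystem {Φ : Pred Carrierᴹ ℓ} (isRootSystem : IsRootSystem E Φ) where
    open IsRootSystem isRootSystem

    private
      p : Fin (proj₁ finite) → Carrierᴹ
      p = proj₁ (proj₂ finite)

      index : ∀ {x} → x ∈ Φ → ∃ λ i → x ≈ᴹ p i
      index = proj₁ (proj₂ (proj₂ finite))

      unindex : ∀ {x} → (∃ λ i → x ≈ᴹ p i) → x ∈ Φ
      unindex = proj₂ (proj₂ (proj₂ finite))

    ⟨α,α⟩≉0 : ∀ {α} → α ∈ Φ → ¬ ⟨ α , α ⟩ ≈ 0#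
    ⟨α,α⟩≉0 {α} α∈Φ αα≈0 with i , α≈pᵢ ← index α∈Φ =
      -- `Φ` is not assumed to respect `≈ᴹ`; the enumeration describes it up to `≈ᴹ`, so membership
      -- passes from α to `0ᴹ` through it.
      0∉Φ (unindex (i , ≈ᴹ-trans (≈ᴹ-sym (⟨⟩-nondeg α αα≈0)) α≈pᵢ))

    -- The graph of non-orthogonality: any two roots have a common neighbour.

    Linked : Carrierᴹ → Carrierᴹ → Carrierᴹ → Set ℓ
    Linked α β γ = ¬ ⟨ γ , α ⟩ ≈ 0# × ¬ ⟨ γ , β ⟩ ≈ 0#

    -- The intermediate root ranges over the enumeration, so that the predicate
    -- is decidable.
    TwoStep : Carrierᴹ → Pred Carrierᴹ ℓ
    TwoStep α β = ∃ λ i → Linked α β (p i)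

    twoStep? : ∀ α β → Dec (TwoStep α β)
    twoStep? α β = any? (λ i → ¬? (⟨ p i , α ⟩ ≟ 0#) ×-dec ¬? (⟨ p i , β ⟩ ≟ 0#))

    linked⇒twoStep : ∀ {α β γ} → γ ∈ Φ → Linked α β γ → TwoStep α β
    linked⇒twoStep {α} {β} {γ} γ∈Φ (γα≉0 , γβ≉0) with i , γ≈pᵢ ← index γ∈Φ =
      i , (λ e → γα≉0 (trans (⟨⟩-congʳ α) e)) , (λ e → γβ≉0 (trans (⟨⟩-congʳ β) e))
      where
      ⟨⟩-congʳ : ∀ δ → ⟨ γ , δ ⟩ ≈ ⟨ p i , δ ⟩
      ⟨⟩-congʳ δ = LinearFunctional.⟦⟧-cong _ (⟨⟩-linear δ) γ≈pᵢ

    -- A path α - δ - β - γ of pairwise non-orthogonal neighbours is shortened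
    -- to α - s_δ β - γ, unless α - β or δ - γ already shortens it.
    twoStep-⊥ : ∀ {α β γ} → β ∈ Φ → TwoStep α β → ¬ TwoStep α γ → ⟨ β , γ ⟩ ≈ 0#
    twoStep-⊥ {α} {β} {γ} β∈Φ (i , δα≉0 , δβ≉0) ¬αγ =
      decidable-stable (⟨ β , γ ⟩ ≟ 0#) contradictory
      where
      δ : Carrierᴹ
      δ = p i
      δ∈Φ : δ ∈ Φ
      δ∈Φ = unindex (i , ≈ᴹ-refl)

      contradictory : ¬ ¬ ⟨ β , γ ⟩ ≈ 0#
      contradictory βγ≉0 with ⟨ β , α ⟩ ≟ 0# | ⟨ δ , γ ⟩ ≟ 0#
      ... | no βα≉0 | _ = ¬αγ (linked⇒twoStep β∈Φ (βα≉0 , βγ≉0))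
      ... | yes _ | no δγ≉0 = ¬αγ (i , δα≉0 , δγ≉0)
      ... | yes βα≈0 | yes δγ≈0 =
        ¬αγ (linked⇒twoStep (reflection δ∈Φ β∈Φ) (s-α≉0 , s-γ≉0))
        where
        s-γ≉0 : ¬ ⟨ reflect E δ β , γ ⟩ ≈ 0#
        s-γ≉0 e = βγ≉0 (trans (sym (⟨⟩-reflect-⊥ β δγ≈0)) e)

        βδ≉0 : ¬ ⟨ β , δ ⟩ ≈ 0#
        βδ≉0 e = δβ≉0 (trans (⟨⟩-sym δ β) e)

        s-α≉0 : ¬ ⟨ reflect E δ β , α ⟩ ≈ 0#
        -- As β is orthogonal to α, only the correction term of the reflection pairs with α; it is a
        -- product, and its Cartan factor is nonzero.
        s-α≉0 e = δα≉0 (x*y≈0⇒y≈0 (cartan≉0 (⟨α,α⟩≉0 δ∈Φ) βδ≉0) (begin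
          cartan E β δ * ⟨ δ , α ⟩            ≈⟨ -‿involutive _ ⟨
          - - (cartan E β δ * ⟨ δ , α ⟩)      ≈⟨ -‿cong (+-identityˡ _) ⟨
          - (0# + - (cartan E β δ * ⟨ δ , α ⟩))  ≈⟨ -‿cong (+-congʳ βα≈0) ⟨
          - (⟨ β , α ⟩ + - (cartan E β δ * ⟨ δ , α ⟩))  ≈⟨ -‿cong (⟨⟩-reflect δ β α) ⟨
          - ⟨ reflect E δ β , α ⟩             ≈⟨ -‿cong e ⟩
          - 0#                                ≈⟨ -0#≈0# ⟩
          0#                                  ∎))

    -- Fix α. By `twoStep-⊥`, the roots with a common neighbour with α are orthogonal to all the
    -- others, so irreducibility rules out any others. Decidability of `TwoStep` provides the
    -- splitting and turns the double negation into a witness.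
    linked-exists : Irreducible E Φ → ∀ {α β} → α ∈ Φ → β ∈ Φ →
                    ∃ λ γ → γ ∈ Φ × Linked α β γ
    linked-exists (_ , indecomposable) {α} {β} α∈Φ β∈Φ =
      let i , linked = decidable-stable (twoStep? α β) αβ
      in p i , unindex (i , ≈ᴹ-refl) , linked
      where
      αα≉0 : ¬ ⟨ α , α ⟩ ≈ 0#
      αα≉0 = ⟨α,α⟩≉0 α∈Φ

      split : ∀ {x} → x ∈ Φ → (x ∈ Φ × TwoStep α x) ⊎ (x ∈ Φ × ¬ TwoStep α x)
      split {x} x∈Φ with twoStep? α x
      ... | yes αx  = inj₁ (x∈Φ , αx)
      ... | no ¬αx = inj₂ (x∈Φ , ¬αx)

      αβ : ¬ ¬ TwoStep α β
      αβ ¬αβ = indecomposable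
        ( (λ x → x ∈ Φ × TwoStep α x) , (λ x → x ∈ Φ × ¬ TwoStep α x)
        -- The first part contains α, because α is not orthogonal to itself and so serves as the
        -- intermediate root.
        , (α , α∈Φ , linked⇒twoStep α∈Φ (αα≉0 , αα≉0))
        , (β , β∈Φ , ¬αβ)
        , (split , [ proj₁ , proj₁ ]′)
        , λ (x∈Φ , αx) (_ , ¬αy) → twoStep-⊥ x∈Φ αx ¬αy )

    -- If the Cartan integer is negative, reflecting in α changes its sign. The last clause lets the
    -- construction be repeated for a root orthogonal to α without undoing the first application.
    make-positive : ∀ {α γ} → α ∈ Φ → γ ∈ Φ → ¬ ⟨ γ , α ⟩ ≈ 0# →
      ∃ λ γ′ → γ′ ∈ Φ × 1# ≤ cartan E γ′ α ×
               (∀ {β} → ⟨ α , β ⟩ ≈ 0# → ⟨ γ′ , β ⟩ ≈ ⟨ γ , β ⟩)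
    make-positive {α} {γ} α∈Φ γ∈Φ γα≉0
      with nonzero-integer (crystallographic α∈Φ γ∈Φ) (cartan≉0 (⟨α,α⟩≉0 α∈Φ) γα≉0)
    ... | inj₁ 1≤n  = γ , γ∈Φ , 1≤n , λ _ → refl
    ... | inj₂ 1≤-n =
      reflect E α γ , reflection α∈Φ γ∈Φ ,
      ≤-trans 1≤-n (≤-reflexive (sym (cartan-reflect-self γ (⟨α,α⟩≉0 α∈Φ)))) ,
      ⟨⟩-reflect-⊥ γ

    -- Linear functionals bounded above on the roots.

    module _ {f : Carrierᴹ → Carrier} {c : Carrier}
             (f-linear : IsLinearFunctional ℝ vectorSpace f)
             (f≤c : ∀ {x} → x ∈ Φ → f x ≤ c) where
      open LinearFunctional f f-linear
      module ≤ = PosetReasoning (DecTotalOrder.poset decTotalOrder)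

      -- The reflection of x in itself is - x, again a root, so the upper bound applies to it.
      functional-lower-bound : ∀ {x} → x ∈ Φ → - c ≤ f x
      functional-lower-bound {x} x∈Φ = ≤.begin
        - c                  ≤.≤⟨ neg-antimono-≤ (f≤c (reflection x∈Φ x∈Φ)) ⟩
        - f (reflect E x x)  ≤.≈⟨ -‿cong (reflect-homo x x) ⟩
        - (f x + - (cartan E x x * f x))
                             ≤.≈⟨ -‿cong (+-congˡ (-‿cong (*-congʳ (cartan-self (⟨α,α⟩≉0 x∈Φ))))) ⟩
        - (f x + - (2# * f x))  ≤.≈⟨ -‿cong (x-2x≈-x (f x)) ⟩
        - - f x              ≤.≈⟨ -‿involutive (f x) ⟩
        f x                  ≤.∎

      -- Both reflections are needed for this estimate: one alone yields f γ ≥ (m - 1) c, which is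
      -- only f γ ≥ 0 when m = 1; the second adds n c.
      maximal : ∀ {α β γ} → α ∈ Φ → β ∈ Φ → γ ∈ Φ → ⟨ α , β ⟩ ≈ 0# →
                f α ≈ c → f β ≈ c → 1# ≤ cartan E γ α → 1# ≤ cartan E γ β → f γ ≈ c
      maximal {α} {β} {γ} α∈Φ β∈Φ γ∈Φ α⊥β fα≈c fβ≈c 1≤m 1≤n =
        antisym (f≤c γ∈Φ) (≤.begin
          c                    ≤.≈⟨ +-identityˡ c ⟨
          0# + c               ≤.≤⟨ +-monoʳ-≤ 0# (1≤x⇒y≤x*y 1≤n 0≤c) ⟩
          -- Writing 0 as - c + c supplies a second c, which is then enlarged to m * c.
          0# + n * c           ≤.≈⟨ +-congʳ (-‿inverseˡ c) ⟨
          (- c + c) + n * c    ≤.≤⟨ +-monoˡ-≤ (n * c) (+-monoʳ-≤ (- c) (1≤x⇒y≤x*y 1≤m 0≤c)) ⟩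
          (- c + m * c) + n * c  ≤.≤⟨ x≤y-z⇒x+z≤y (x≤y-z⇒x+z≤y -c≤fγ-nc-mc) ⟩
          f γ                  ≤.∎)
        where
        m n : Carrier
        m = cartan E γ α
        n = cartan E γ β

        0≤c : 0# ≤ c
        -- The value c is attained at the root α, where f is also at least - c.
        0≤c = -x≤x⇒0≤x (≤-trans (functional-lower-bound α∈Φ) (≤-reflexive fα≈c))

        sγ : Carrierᴹ
        sγ = reflect E β γ
        sγ∈Φ : sγ ∈ Φ
        sγ∈Φ = reflection β∈Φ γ∈Φ

        -c≤fγ-nc-mc : - c ≤ (f γ + - (n * c)) + - (m * c)
        -c≤fγ-nc-mc = ≤.begin
          - c                                ≤.≤⟨ functional-lower-bound (reflection α∈Φ sγ∈Φ) ⟩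
          f (reflect E α sγ)                 ≤.≈⟨ reflect-homo α sγ ⟩
          -- Since β is orthogonal to α, the Cartan number of `sγ` with α is still m.
          f sγ + - (cartan E sγ α * f α)     ≤.≈⟨ +-cong (reflect-homo β γ)
                                               (-‿cong (*-cong (cartan-reflect-⊥ γ (trans (⟨⟩-sym β α) α⊥β)) fα≈c)) ⟩
          (f γ + - (n * f β)) + - (m * c)    ≤.≈⟨ +-congʳ (+-congˡ (-‿cong (*-congˡ fβ≈c))) ⟩
          (f γ + - (n * c)) + - (m * c)      ≤.∎

-- A root of the face that fits in neither part of an orthogonal splitting.

theorem5p2 : {ℓ : Level} (ℝ : RealField ℓ) (E : InnerProductSpace ℝ)
    (Φ : Pred (InnerProductSpace.Carrierᴹ E) ℓ) →
    IsRootSystem E Φ → Irreducible E Φ →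
    (F : Pred (InnerProductSpace.Carrierᴹ E) ℓ) → IsFace E (ConvexHull E Φ) F →
    ¬ OrthogonallyDecomposable E (Φ ∩ F)
theorem5p2 ℝ E Φ isRootSystem irreducible F
  (_ , f , c , f-linear , f≤c , F⊆ , ⊆F)
  (S₁ , S₂ , (α , α∈S₁) , (β , β∈S₂) , (⊆S₁∪S₂ , S₁∪S₂⊆) , S₁⊥S₂)
  = contradictory
  where
  open RealField ℝ
  open InnerProductSpace E
  open OrderedField ℝ
  open RootSystem E isRootSystem

  α⊥β : ⟨ α , β ⟩ ≈ 0#
  α⊥β = S₁⊥S₂ α∈S₁ β∈S₂

  β⊥α : ⟨ β , α ⟩ ≈ 0#
  β⊥α = trans (⟨⟩-sym β α) α⊥β

  α∈Φ∩F : α ∈ Φ ∩ F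
  α∈Φ∩F = S₁∪S₂⊆ (inj₁ α∈S₁)

  β∈Φ∩F : β ∈ Φ ∩ F
  β∈Φ∩F = S₁∪S₂⊆ (inj₂ β∈S₂)

  contradictory : ⊥
  contradictory
    with γ , γ∈Φ , γα≉0 , γβ≉0 ← linked-exists irreducible (proj₁ α∈Φ∩F) (proj₁ β∈Φ∩F)
    with γ₁ , γ₁∈Φ , 1≤m , γ₁~γ ← make-positive (proj₁ α∈Φ∩F) γ∈Φ γα≉0
    -- The passage from γ to γ₁ keeps the product with β, which is therefore still nonzero.
    with γ₂ , γ₂∈Φ , 1≤n , γ₂~γ₁ ← make-positive (proj₁ β∈Φ∩F) γ₁∈Φ
                                     (λ e → γβ≉0 (trans (sym (γ₁~γ α⊥β)) e))
    -- Membership in `S₁` would make γ₂ orthogonal to β, membership in `S₂` orthogonal to α; either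
    -- contradicts a positive Cartan number.
    = [ (λ γ₂∈S₁ → positive 1≤n (S₁⊥S₂ γ₂∈S₁ β∈S₂))
      , (λ γ₂∈S₂ → positive 1≤m′ (trans (⟨⟩-sym γ₂ α) (S₁⊥S₂ α∈S₁ γ₂∈S₂)))
      ]′ (⊆S₁∪S₂ (γ₂∈Φ , ⊆F (⊆-ConvexHull E γ₂∈Φ , fγ₂≈c)))
    where
    1≤m′ : 1# ≤ cartan E γ₂ α
    -- Making the Cartan number with β positive leaves the product with α unchanged, as α is
    -- orthogonal to β.
    1≤m′ = ≤-trans 1≤m (≤-reflexive (sym (cartan-congˡ E α (γ₂~γ₁ β⊥α))))

    fγ₂≈c : f γ₂ ≈ c
    fγ₂≈c = maximal f-linear (λ x∈Φ → f≤c (⊆-ConvexHull E x∈Φ))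
      (proj₁ α∈Φ∩F) (proj₁ β∈Φ∩F) γ₂∈Φ α⊥β
      (proj₂ (F⊆ (proj₂ α∈Φ∩F))) (proj₂ (F⊆ (proj₂ β∈Φ∩F))) 1≤m′ 1≤n

    positive : ∀ {δ} → 1# ≤ cartan E γ₂ δ → ¬ ⟨ γ₂ , δ ⟩ ≈ 0#
    positive 1≤k e = 0≉1 (antisym 0≤1 (≤-trans 1≤k (≤-reflexive
      (trans (*-congʳ (trans (*-congˡ e) (zeroʳ _))) (zeroˡ _)))))
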